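{- Let $G:\mathbb{Z}_{\ge 0}\to\mathbb{Z}_{\ge 0}$ be the function defined by: $G(n)$ is the largest integer $k$ with $0\le k\le n$ such that multiset-reconstructibility holds for $(n,k)$. Then \[ \lim_{n\to\infty}\frac{G(n)}{n}=1, \] and moreover $n-G(n)=O(n/\log n)$ as $n\to\infty$.
   Context: A partition $\lambda=[\lambda_1,\lambda_2,\dots]$ of $n\in\mathbb{Z}_{\ge0}$ is a weakly decreasing sequence of non-negative integers with sum $n$. For partitions $\mu,\lambda$ write $\mu\le\lambda$ if $\mu_i\le\lambda_i$ for all $i$. For $n\ge k\ge 0$ and $\lambda\vdash n$, a $k$-minor of $\lambda$ is a partition $\mu\vdash n-k$ with $\mu\le\lambda$. $N(\lambda/\mu)$ denotes the number of standard Young tableaux of skew shape $\lambda/\mu$ (with $N(\lambda/\mu)=0$ if $\mu\not\le\lambda$). $\widehat{M}_k(\lambda)$ is the multiset of $k$-minors $\mu$ of $\lambda$, each $\mu$ having multiplicity $N(\lambda/\mu)$; thus $\widehat{M}_k(\lambda)=\widehat{M}_k(\nu)$ means $N(\lambda/\tau)=N(\nu/\tau)$ for all $\tau\vdash n-k$. Multiset-reconstructibility holds for $(n,k)$ (with $n\ge k\ge0$) if for all partitions $\mu,\nu$ of $n$, $\widehat{M}_k(\mu)=\widehat{M}_k(\nu)$ implies $\mu=\nu$. (It holds trivially for $k=0$.) $\log$ is the natural logarithm. -}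

module Defs where

open import Data.Nat using (ℕ; zero; suc; _∸_; _≤_; _<_; _<ᵇ_; pred)
open import Data.Nat.Properties using (_≟_)
open import Data.Bool using (Bool; true; false; if_then_else_)
open import Data.List using (List; []; _∷_; _++_; map; [_])
open import Data.Nat.ListAction using (sum)
open import Data.List.Relation.Unary.All using (All)
open import Data.List.Relation.Unary.Linked using (Linked)
open import Data.List.Properties using (≡-dec)
open import Data.Product using (_×_)
open import Relation.Nullary using (yes; no)
open import Relation.Binary.PropositionalEquality using (_≡_)

_≥ℕ_ : ℕ → ℕ → Set
a ≥ℕ b = b ≤ a

IsPartition : List ℕ → Set
IsPartition l = All (λ a → 0 < a) l × Linked _≥ℕ_ l

IsPartitionOf : ℕ → List ℕ → Set
IsPartitionOf n l = IsPartition l × sum l ≡ n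

removeBox : List ℕ → List (List ℕ)
removeBox [] = []
removeBox (a ∷ []) with pred a
... | zero  = [ [] ]
... | suc c = [ suc c ∷ [] ]
removeBox (a ∷ b ∷ rest) =
  (if b <ᵇ a then [ pred a ∷ b ∷ rest ] else [])
  ++ map (a ∷_) (removeBox (b ∷ rest))

chains : ℕ → List ℕ → List ℕ → ℕ
chains zero lam mu with ≡-dec _≟_ lam mu
... | yes _ = 1
... | no  _ = 0
chains (suc k) lam mu = sum (map (λ r → chains k r mu) (removeBox lam))

-- N(λ/μ): number of standard Young tableaux of skew shape λ/μ
-- (= number of saturated chains from μ up to λ; 0 if μ ⊄ λ).
N : List ℕ → List ℕ → ℕ
N lam mu = chains (sum lam ∸ sum mu) lam mu

MultisetReconstructible : ℕ → ℕ → Set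
MultisetReconstructible n k =
  (mu nu : List ℕ) → IsPartitionOf n mu → IsPartitionOf n nu →
  ((tau : List ℕ) → IsPartitionOf (n ∸ k) tau → N mu tau ≡ N nu tau) →
  mu ≡ nu

{-# OPTIONS --safe #-}

-- Let lᵢ = λᵢ + n − i, let D be the sum over i of the shifts φ ↦ φ (l − eᵢ) acting on alternating
-- functions of l ∈ ℕⁿ, and let V be the Vandermonde product. On alternating functions D removes a
-- box in all possible ways, so the multiset of k-minors of λ ⊢ n determines (D^k χ)(l) for every
-- alternating χ, and (D^n V)(l) > 0. The commutator of D with multiplication by Σᵢ g(lᵢ) is
-- a sum of shifts weighted by the finite difference of g, so commutators iterate to zero when g is
-- a polynomial; if deg g ≤ m = n − k, then (Σᵢ g(lᵢ)) D^n V = D^k χ for some alternating χ. Hence the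
-- k-minors determine Σᵢ g(lᵢ) for all polynomials g of degree at most m. If two strictly decreasing
-- sequences in [0 , 2n] first differ at an entry x of one of them, x larger than what follows in
-- both, a power of a Chebyshev polynomial that is small on [0 , x − 1] and large at x separates the
-- sums; its degree is O(√n log n), well below n / log n.

module Submission where

open import Defs
open import Data.Nat using (ℕ; _∸_; _≤_; _*_)
open import Data.Nat.Logarithm using (⌊log₂_⌋)
open import Data.Product using (_×_; ∃)

open import Algebra.Properties.AbelianGroup using (∙-cancelˡ)
open import Data.Bool using (true; false; T; if_then_else_)
open import Data.Integer as ℤ using (ℤ; +_; -[1+_]; 0ℤ; 1ℤ; ∣_∣; +<+)
import Data.Integer.Properties as ℤ
open import Data.Integer.Tactic.RingSolver using (solve-∀)
open import Data.List using (List; []; _∷_; _++_; map; length; concatMap; [_])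
open import Data.List.Membership.Propositional using (_∈_)
open import Data.List.Membership.Propositional.Properties using (∈-∃++)
open import Data.List.Properties using (≡-dec; length-map; ∷-injectiveˡ; ∷-injectiveʳ)
open import Data.List.Relation.Unary.All as All using (All; []; _∷_)
import Data.List.Relation.Unary.All.Properties as All
open import Data.List.Relation.Unary.AllPairs using (AllPairs; []; _∷_)
open import Data.List.Relation.Unary.Any using (here; there)
open import Data.List.Relation.Unary.Linked using (Linked; []; [-]; _∷_)
open import Data.List.Relation.Unary.Linked.Properties using (Linked⇒AllPairs)
open import Data.Nat using (zero; suc; _<_; _>_; _+_; _^_; _/_; _%_; _<ᵇ_; z≤n; s≤s; >-nonZero)
open import Data.Nat.DivMod using (m≡m%n+[m/n]*n; m%n<n)
open import Data.Nat.ListAction using (sum)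
open import Data.Nat.Logarithm using (⌊log₂⌋-mono-≤; ⌊log₂[2*b]⌋≡1+⌊log₂b⌋; ⌊log₂[2^n]⌋≡n)
import Data.Nat.Properties as ℕ
import Data.Nat.Tactic.RingSolver as ℕ-Solver
open import Data.Product using (_,_; proj₁; proj₂)
open import Data.Sum using (inj₁; inj₂)
open import Data.Unit using (tt)
open import Function using (_∘_; flip)
open import Relation.Binary using (tri<; tri≈; tri>)
open import Relation.Binary.PropositionalEquality hiding ([_])
open import Relation.Nullary using (¬_; yes; no; contradiction)

-- Weighted shift operators on functions of integer sequences.

Functional : Set
Functional = List ℕ → ℤ

∑ : {A : Set} → (A → ℤ) → List A → ℤ
∑ f []       = 0ℤ
∑ f (x ∷ xs) = f x ℤ.+ ∑ f xs

-- Arguments that would become negative count as 0, so functions live on `ℕ` only. In `D` this drops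
-- the lowering of a last entry 0, which belongs to an empty row and has no box to lose.
shift : ℕ → (ℕ → ℤ) → ℕ → ℤ
shift zero    h a       = h a
shift (suc s) h zero    = 0ℤ
shift (suc s) h (suc a) = shift s h a

shift-cong : ∀ s {h h′} → (∀ a → h a ≡ h′ a) → ∀ a → shift s h a ≡ shift s h′ a
shift-cong zero    eq a       = eq a
shift-cong (suc s) eq zero    = refl
shift-cong (suc s) eq (suc a) = shift-cong s eq a

shift-+ : ∀ s h h′ a → shift s (λ b → h b ℤ.+ h′ b) a ≡ shift s h a ℤ.+ shift s h′ a
shift-+ zero    h h′ a       = refl
shift-+ (suc s) h h′ zero    = refl
shift-+ (suc s) h h′ (suc a) = shift-+ s h h′ a

shift-neg : ∀ s h a → shift s (λ b → ℤ.- h b) a ≡ ℤ.- shift s h a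
shift-neg zero    h a       = refl
shift-neg (suc s) h zero    = refl
shift-neg (suc s) h (suc a) = shift-neg s h a

-- lower g s φ l = Σᵢ g (lᵢ − s) φ (l − s eᵢ), where the terms with lᵢ < s are 0.
lower : (ℕ → ℤ) → ℕ → Functional → Functional
lower g s φ []      = 0ℤ
lower g s φ (a ∷ l) = shift s (λ b → g b ℤ.* φ (b ∷ l)) a ℤ.+ lower g s (φ ∘ (a ∷_)) l

lower-cong : ∀ g s {φ ψ} → φ ≗ ψ → lower g s φ ≗ lower g s ψ
lower-cong g s eq []      = refl
lower-cong g s eq (a ∷ l) = cong₂ ℤ._+_
  (shift-cong s (λ b → cong (g b ℤ.*_) (eq (b ∷ l))) a)
  (lower-cong g s (eq ∘ (a ∷_)) l)

lower-+ : ∀ g s φ ψ l → lower g s (λ l → φ l ℤ.+ ψ l) l ≡ lower g s φ l ℤ.+ lower g s ψ l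
lower-+ g s φ ψ []      = refl
lower-+ g s φ ψ (a ∷ l) = begin
  shift s (λ b → g b ℤ.* (φ (b ∷ l) ℤ.+ ψ (b ∷ l))) a
    ℤ.+ lower g s (λ l → φ (a ∷ l) ℤ.+ ψ (a ∷ l)) l
    ≡⟨ cong₂ ℤ._+_
         (trans (shift-cong s (λ b → ℤ.*-distribˡ-+ (g b) (φ (b ∷ l)) (ψ (b ∷ l))) a)
                (shift-+ s x y a))
         (lower-+ g s (φ ∘ (a ∷_)) (ψ ∘ (a ∷_)) l) ⟩
  (shift s x a ℤ.+ shift s y a) ℤ.+ (z ℤ.+ w) ≡⟨ interchange (shift s x a) (shift s y a) z w ⟩
  lower g s φ (a ∷ l) ℤ.+ lower g s ψ (a ∷ l) ∎
  where
  open ≡-Reasoning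
  x y : ℕ → ℤ
  x b = g b ℤ.* φ (b ∷ l)
  y b = g b ℤ.* ψ (b ∷ l)
  z = lower g s (φ ∘ (a ∷_)) l
  w = lower g s (ψ ∘ (a ∷_)) l
  interchange : ∀ w x y z → (w ℤ.+ x) ℤ.+ (y ℤ.+ z) ≡ (w ℤ.+ y) ℤ.+ (x ℤ.+ z)
  interchange = solve-∀

lower-neg : ∀ g s φ l → lower g s (λ l → ℤ.- φ l) l ≡ ℤ.- lower g s φ l
lower-neg g s φ []      = refl
lower-neg g s φ (a ∷ l) = begin
  shift s (λ b → g b ℤ.* (ℤ.- φ (b ∷ l))) a ℤ.+ _
    ≡⟨ cong₂ ℤ._+_
         (trans (shift-cong s (λ b → sym (ℤ.neg-distribʳ-* (g b) (φ (b ∷ l)))) a)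
                (shift-neg s _ a))
         (lower-neg g s (φ ∘ (a ∷_)) l) ⟩
  _ ≡⟨ ℤ.neg-distrib-+ (shift s _ a) _ ⟨
  _ ∎
  where open ≡-Reasoning

lower-zero : ∀ g s l → lower g s (λ _ → 0ℤ) l ≡ 0ℤ
lower-zero g s l = begin
  lower g s (λ _ → 0ℤ) l   ≡⟨ doubled ⟩
  x ℤ.+ x                  ≡⟨ cong (ℤ._+_ x) (lower-neg g s (λ _ → 0ℤ) l) ⟩
  x ℤ.+ ℤ.- x              ≡⟨ ℤ.+-inverseʳ x ⟩
  0ℤ                       ∎
  where
  open ≡-Reasoning
  x = lower g s (λ _ → 0ℤ) l
  doubled : x ≡ x ℤ.+ x
  doubled = lower-+ g s (λ _ → 0ℤ) (λ _ → 0ℤ) l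

lower-* : ∀ g s c φ l → lower g s (λ l → c ℤ.* φ l) l ≡ c ℤ.* lower g s φ l
lower-* g s c φ []      = sym (ℤ.*-zeroʳ c)
lower-* g s c φ (a ∷ l) = begin
  shift s (λ b → g b ℤ.* (c ℤ.* φ (b ∷ l))) a ℤ.+ _
    ≡⟨ cong₂ ℤ._+_ (scale s a) (lower-* g s c (φ ∘ (a ∷_)) l) ⟩
  _ ≡⟨ ℤ.*-distribˡ-+ c (shift s _ a) _ ⟨
  _ ∎
  where
  open ≡-Reasoning
  swap : ∀ x y z → x ℤ.* (y ℤ.* z) ≡ y ℤ.* (x ℤ.* z)
  swap = solve-∀
  scale : ∀ s a → shift s (λ b → g b ℤ.* (c ℤ.* φ (b ∷ l))) a ≡ c ℤ.* shift s (λ b → g b ℤ.* φ (b ∷ l)) a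
  scale zero    a       = swap (g a) c (φ (a ∷ l))
  scale (suc s) zero    = sym (ℤ.*-zeroʳ c)
  scale (suc s) (suc a) = scale s a

-- Shifting the head and shifting entries of the tail commute, since they act on different
-- positions. This covers the mixed terms of the commutator below.
lower-shift : ∀ g s t (h : ℕ → ℤ) (ψ : ℕ → Functional) a l →
  lower g s (λ l → shift t (λ b → h b ℤ.* ψ b l) a) l ≡ shift t (λ b → h b ℤ.* lower g s (ψ b) l) a
lower-shift g s zero    h ψ a       l = lower-* g s (h a) (ψ a) l
lower-shift g s (suc t) h ψ zero    l = lower-zero g s l
lower-shift g s (suc t) h ψ (suc a) l = lower-shift g s t h ψ a l

lower-0 : ∀ g φ l → lower g 0 φ l ≡ ∑ g l ℤ.* φ l
lower-0 g φ []      = refl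
lower-0 g φ (a ∷ l) = trans (cong (ℤ._+_ (g a ℤ.* φ (a ∷ l))) (lower-0 g (φ ∘ (a ∷_)) l))
  (sym (ℤ.*-distribʳ-+ (φ (a ∷ l)) (g a) (∑ g l)))

-- The operator `D` and its commutator with weighted shifts.

one : ℕ → ℤ
one _ = 1ℤ

D : Functional → Functional
D = lower one 1

D^ : ℕ → Functional → Functional
D^ zero    φ = φ
D^ (suc k) φ = D (D^ k φ)

D^-+ : ∀ k φ ψ l → D^ k (λ l → φ l ℤ.+ ψ l) l ≡ D^ k φ l ℤ.+ D^ k ψ l
D^-+ zero    φ ψ l = refl
D^-+ (suc k) φ ψ l = trans (lower-cong one 1 (D^-+ k φ ψ) l) (lower-+ one 1 (D^ k φ) (D^ k ψ) l)

D^-D^ : ∀ k m φ l → D^ (k + m) φ l ≡ D^ k (D^ m φ) l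
D^-D^ zero    m φ l = refl
D^-D^ (suc k) m φ l = lower-cong one 1 (D^-D^ k m φ) l

Δ : (ℕ → ℤ) → ℕ → ℤ
Δ g a = g (suc a) ℤ.- g a

-- Shifts at two different positions commute. At one position both orders give φ (l - (s + 1) eᵢ),
-- with weight g (lᵢ - s) on the left and g (lᵢ - s - 1) in the first term on the right; the
-- difference of the weights is `Δ g`.
lower-D : ∀ g s φ l → lower g s (D φ) l ≡ D (lower g s φ) l ℤ.+ lower (Δ g) (suc s) φ l
lower-D g s φ []      = refl
lower-D g s φ (a ∷ l) = begin
  shift s (λ b → g b ℤ.* (shift 1 (λ c → 1ℤ ℤ.* φ (c ∷ l)) b ℤ.+ D (φ ∘ (b ∷_)) l)) a
    ℤ.+ lower g s (λ l → shift 1 (λ c → 1ℤ ℤ.* φ (c ∷ l)) a ℤ.+ D (φ ∘ (a ∷_)) l) l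
    ≡⟨ cong₂ ℤ._+_
         (trans (shift-cong s (λ b → ℤ.*-distribˡ-+ (g b) _ _) a) (shift-+ s _ _ a))
         (lower-+ g s _ _ l) ⟩
  (shift s (λ b → g b ℤ.* shift 1 (λ c → 1ℤ ℤ.* φ (c ∷ l)) b) a
     ℤ.+ shift s (λ b → g b ℤ.* D (φ ∘ (b ∷_)) l) a)
    ℤ.+ (lower g s (λ l → shift 1 (λ c → 1ℤ ℤ.* φ (c ∷ l)) a) l
     ℤ.+ lower g s (D (φ ∘ (a ∷_))) l)
    ≡⟨ cong₂ ℤ._+_
         (cong₂ ℤ._+_ (diagonal s a) (sym (lower-shift one 1 s g (λ b → φ ∘ (b ∷_)) a l)))
         (cong₂ ℤ._+_ (lower-shift g s 1 one (λ b → φ ∘ (b ∷_)) a l)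
                      (lower-D g s (φ ∘ (a ∷_)) l)) ⟩
  ((X ℤ.+ Y) ℤ.+ Z) ℤ.+ (U ℤ.+ (V ℤ.+ W))
    ≡⟨ regroup X Y Z U V W ⟩
  ((X ℤ.+ U) ℤ.+ (Z ℤ.+ V)) ℤ.+ (Y ℤ.+ W)
    ≡⟨ cong (ℤ._+ (Y ℤ.+ W)) (cong₂ ℤ._+_ expand (lower-+ one 1 _ _ l)) ⟨
  D (lower g s φ) (a ∷ l) ℤ.+ lower (Δ g) (suc s) φ (a ∷ l) ∎
  where
  open ≡-Reasoning
  -- `X` and `Y` come from the head alone, `Z` and `U` pair the head with the tail, `V` and `W` come
  -- from the tail alone.
  X = shift 1 (λ b → 1ℤ ℤ.* shift s (λ c → g c ℤ.* φ (c ∷ l)) b) a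
  Y = shift (suc s) (λ b → Δ g b ℤ.* φ (b ∷ l)) a
  Z = D (λ l → shift s (λ b → g b ℤ.* φ (b ∷ l)) a) l
  U = shift 1 (λ b → 1ℤ ℤ.* lower g s (φ ∘ (b ∷_)) l) a
  V = D (lower g s (φ ∘ (a ∷_))) l
  W = lower (Δ g) (suc s) (φ ∘ (a ∷_)) l

  regroup : ∀ x y z u v w →
    ((x ℤ.+ y) ℤ.+ z) ℤ.+ (u ℤ.+ (v ℤ.+ w)) ≡ ((x ℤ.+ u) ℤ.+ (z ℤ.+ v)) ℤ.+ (y ℤ.+ w)
  regroup = solve-∀

  expand : shift 1 (λ b → 1ℤ ℤ.* lower g s φ (b ∷ l)) a ≡ X ℤ.+ U
  expand = trans (shift-cong 1 (λ b → ℤ.*-distribˡ-+ 1ℤ (shift s _ b) _) a) (shift-+ 1 _ _ a)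

  split : ∀ p q r → p ℤ.* (1ℤ ℤ.* r) ≡ 1ℤ ℤ.* (q ℤ.* r) ℤ.+ (p ℤ.- q) ℤ.* r
  split = solve-∀


  diagonal : ∀ s a → shift s (λ b → g b ℤ.* shift 1 (λ c → 1ℤ ℤ.* φ (c ∷ l)) b) a
    ≡ shift 1 (λ b → 1ℤ ℤ.* shift s (λ c → g c ℤ.* φ (c ∷ l)) b) a
        ℤ.+ shift (suc s) (λ b → Δ g b ℤ.* φ (b ∷ l)) a
  -- At the boundary a = s the second shift already leaves `ℕ`, so the left side is `g 0` times 0.
  diagonal zero    zero          = ℤ.*-zeroʳ (g 0)
  diagonal zero    (suc a)       = split (g (suc a)) (g a) (φ (a ∷ l))
  diagonal (suc s) zero          = refl
  diagonal (suc zero)    (suc zero) = ℤ.*-zeroʳ (g 0)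
  diagonal (suc (suc s)) (suc zero) = refl
  diagonal (suc s) (suc (suc a)) = diagonal s (suc a)

-- Alternating functions, and powers of `D` pulled out of weighted shifts.

data _≈ₛ_ : List ℕ → List ℕ → Set where
  here  : ∀ {a b l} → (a ∷ b ∷ l) ≈ₛ (b ∷ a ∷ l)
  there : ∀ {a l l′} → l ≈ₛ l′ → (a ∷ l) ≈ₛ (a ∷ l′)

-- Adjacent transpositions generate all permutations, so the sign rule for them is enough and signs
-- of permutations need not be defined.
Alternating : Functional → Set
Alternating φ = ∀ {l l′} → l ≈ₛ l′ → φ l ≡ ℤ.- φ l′

lower-alternating : ∀ g s {φ} → Alternating φ → Alternating (lower g s φ)
lower-alternating g s {φ} alt (here {a} {b} {l}) = begin
  shift s (λ c → g c ℤ.* φ (c ∷ b ∷ l)) a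
    ℤ.+ (shift s (λ c → g c ℤ.* φ (a ∷ c ∷ l)) b ℤ.+ lower g s (λ l → φ (a ∷ b ∷ l)) l)
    ≡⟨ cong₂ ℤ._+_ (swapped (λ c → c ∷ b ∷ l) (λ c → b ∷ c ∷ l) (λ c → here) a)
         (cong₂ ℤ._+_ (swapped (λ c → a ∷ c ∷ l) (λ c → c ∷ a ∷ l) (λ c → here) b)
           (trans (lower-cong g s (λ l → alt here) l) (lower-neg g s (λ l → φ (b ∷ a ∷ l)) l))) ⟩
  ℤ.- x ℤ.+ (ℤ.- y ℤ.+ ℤ.- z) ≡⟨ regroup x y z ⟩
  ℤ.- (y ℤ.+ (x ℤ.+ z)) ∎
  where
  open ≡-Reasoning
  x = shift s (λ c → g c ℤ.* φ (b ∷ c ∷ l)) a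
  y = shift s (λ c → g c ℤ.* φ (c ∷ a ∷ l)) b
  z = lower g s (λ l → φ (b ∷ a ∷ l)) l
  regroup : ∀ x y z → ℤ.- x ℤ.+ (ℤ.- y ℤ.+ ℤ.- z) ≡ ℤ.- (y ℤ.+ (x ℤ.+ z))
  regroup = solve-∀
  swapped : (u v : ℕ → List ℕ) → (∀ c → u c ≈ₛ v c) → ∀ a →
    shift s (λ c → g c ℤ.* φ (u c)) a ≡ ℤ.- shift s (λ c → g c ℤ.* φ (v c)) a
  swapped u v sw a = trans
    (shift-cong s (λ c → trans (cong (g c ℤ.*_) (alt (sw c))) (sym (ℤ.neg-distribʳ-* (g c) (φ (v c))))) a)
    (shift-neg s _ a)
lower-alternating g s {φ} alt (there {a} {l} {l′} sw) = begin
  shift s (λ c → g c ℤ.* φ (c ∷ l)) a ℤ.+ lower g s (φ ∘ (a ∷_)) l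
    ≡⟨ cong₂ ℤ._+_
         (trans (shift-cong s (λ c → trans (cong (g c ℤ.*_) (alt (there sw)))
                                           (sym (ℤ.neg-distribʳ-* (g c) (φ (c ∷ l′))))) a)
                (shift-neg s _ a))
         (lower-alternating g s (alt ∘ there) sw) ⟩
  ℤ.- x ℤ.+ ℤ.- y ≡⟨ ℤ.neg-distrib-+ x y ⟨
  ℤ.- (x ℤ.+ y) ∎
  where
  open ≡-Reasoning
  x = shift s (λ c → g c ℤ.* φ (c ∷ l′)) a
  y = lower g s (φ ∘ (a ∷_)) l′

D^-alternating : ∀ k {φ} → Alternating φ → Alternating (D^ k φ)
D^-alternating zero    alt = alt
D^-alternating (suc k) alt = lower-alternating one 1 (D^-alternating k alt)

+-alternating : ∀ {φ ψ} → Alternating φ → Alternating ψ → Alternating (λ l → φ l ℤ.+ ψ l)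
+-alternating {φ} {ψ} altφ altψ {l} {l′} sw =
  trans (cong₂ ℤ._+_ (altφ sw) (altψ sw)) (sym (ℤ.neg-distrib-+ (φ l′) (ψ l′)))

alternating-≡0 : ∀ {φ} → Alternating φ → ∀ a l → φ (a ∷ a ∷ l) ≡ 0ℤ
alternating-≡0 {φ} alt a l = self-negative (φ (a ∷ a ∷ l)) (alt here)
  where
  self-negative : ∀ x → x ≡ ℤ.- x → x ≡ 0ℤ
  self-negative (+ zero) eq = refl

-- Polynomials of degree at most r are encoded by the vanishing of their difference of order r + 1.
-- No coefficients appear, and the `Δ` of the commutator lowers the degree by definition.
Degree≤ : ℕ → (ℕ → ℤ) → Set
Degree≤ zero    g = ∀ a → Δ g a ≡ 0ℤ
Degree≤ (suc r) g = Degree≤ r (Δ g)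

lower-≡0 : ∀ {g} s φ → (∀ a → g a ≡ 0ℤ) → ∀ l → lower g s φ l ≡ 0ℤ
lower-≡0 s φ g≡0 [] = refl
lower-≡0 {g} s φ g≡0 (a ∷ l) = cong₂ ℤ._+_ (vanish s a) (lower-≡0 s (φ ∘ (a ∷_)) g≡0 l)
  where
  vanish : ∀ s a → shift s (λ b → g b ℤ.* φ (b ∷ l)) a ≡ 0ℤ
  vanish zero    a       = cong (ℤ._* φ (a ∷ l)) (g≡0 a)
  vanish (suc s) zero    = refl
  vanish (suc s) (suc a) = vanish s a

-- Moving one `D` past the weighted shift leaves a term with `Δ g`: its degree is one less and it
-- has one `D` fewer to its right, so k copies of `D` can still be pulled out of it.
lower-D^ : ∀ r k {g} s {φ} → Degree≤ r g → Alternating φ →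
  ∃ λ χ → Alternating χ × (lower g s (D^ (k + r) φ) ≗ D^ k χ)
lower-D^ r zero {g} s {φ} deg alt =
  lower g s (D^ r φ) , lower-alternating g s (D^-alternating r alt) , λ l → refl
lower-D^ zero (suc k) {g} s {φ} deg alt with lower-D^ zero k s deg alt
... | χ , altχ , eq = χ , altχ , λ l → begin
  lower g s (D (D^ (k + 0) φ)) l                      ≡⟨ lower-D g s (D^ (k + 0) φ) l ⟩
  D (lower g s (D^ (k + 0) φ)) l ℤ.+ lower (Δ g) (suc s) (D^ (k + 0) φ) l
    ≡⟨ cong₂ ℤ._+_ (lower-cong one 1 eq l) (lower-≡0 (suc s) _ deg l) ⟩
  D (D^ k χ) l ℤ.+ 0ℤ                                  ≡⟨ ℤ.+-identityʳ _ ⟩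
  D (D^ k χ) l                                         ∎
  where open ≡-Reasoning
lower-D^ (suc r) (suc k) {g} s {φ} deg alt
  with lower-D^ (suc r) k s deg alt | lower-D^ r (suc k) (suc s) deg alt
... | χ₁ , alt₁ , eq₁ | χ₂ , alt₂ , eq₂ =
  (λ l → χ₁ l ℤ.+ χ₂ l) , +-alternating alt₁ alt₂ , λ l → begin
  lower g s (D (D^ (k + suc r) φ)) l                  ≡⟨ lower-D g s (D^ (k + suc r) φ) l ⟩
  D (lower g s (D^ (k + suc r) φ)) l ℤ.+ lower (Δ g) (suc s) (D^ (k + suc r) φ) l
    ≡⟨ cong₂ ℤ._+_ (lower-cong one 1 eq₁ l)
         (trans (cong (λ j → lower (Δ g) (suc s) (D^ j φ) l) (ℕ.+-suc k r)) (eq₂ l)) ⟩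
  D^ (suc k) χ₁ l ℤ.+ D^ (suc k) χ₂ l                  ≡⟨ D^-+ (suc k) χ₁ χ₂ l ⟨
  D^ (suc k) (λ l → χ₁ l ℤ.+ χ₂ l) l                   ∎
  where open ≡-Reasoning

-- Sums over lists, and `D` as the removal of a box.

∑-++ : {A : Set} (f : A → ℤ) (xs ys : List A) → ∑ f (xs ++ ys) ≡ ∑ f xs ℤ.+ ∑ f ys
∑-++ f []       ys = sym (ℤ.+-identityˡ _)
∑-++ f (x ∷ xs) ys = trans (cong (ℤ._+_ (f x)) (∑-++ f xs ys)) (sym (ℤ.+-assoc (f x) _ _))

∑-map : {A B : Set} (f : B → ℤ) (h : A → B) (xs : List A) → ∑ f (map h xs) ≡ ∑ (f ∘ h) xs
∑-map f h []       = refl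
∑-map f h (x ∷ xs) = cong (ℤ._+_ (f (h x))) (∑-map f h xs)

∑-concatMap : {A B : Set} (f : B → ℤ) (h : A → List B) (xs : List A) →
  ∑ f (concatMap h xs) ≡ ∑ (∑ f ∘ h) xs
∑-concatMap f h []       = refl
∑-concatMap f h (x ∷ xs) =
  trans (∑-++ f (h x) (concatMap h xs)) (cong (ℤ._+_ (∑ f (h x))) (∑-concatMap f h xs))

∑-cong : {A : Set} {P : A → Set} {f h : A → ℤ} → (∀ {x} → P x → f x ≡ h x) →
  ∀ {xs} → All P xs → ∑ f xs ≡ ∑ h xs
∑-cong eq []         = refl
∑-cong eq (px ∷ pxs) = cong₂ ℤ._+_ (eq px) (∑-cong eq pxs)

-- The strictly decreasing sequence λᵢ + d − i (1 ≤ i ≤ d), where λ is padded with zeros.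
β : ℕ → List ℕ → List ℕ
β zero    lam       = []
β (suc d) []        = d ∷ β d []
β (suc d) (a ∷ lam) = a + d ∷ β d lam

-- The entries are d - 1, ..., 1, 0. Lowering any of them but the last repeats its right neighbour,
-- where an alternating function vanishes; lowering the last is dropped.
D-β-[] : ∀ d {φ} → Alternating φ → D φ (β d []) ≡ 0ℤ
D-β-[] zero          alt = refl
D-β-[] (suc zero)    alt = refl
D-β-[] (suc (suc d)) {φ} alt = cong₂ ℤ._+_
  (trans (ℤ.*-identityˡ _) (alternating-≡0 alt d (β d [])))
  (D-β-[] (suc d) (alt ∘ there))

-- Lowering the i-th entry removes a box from row i if that row is longer than the next one. If the
-- two rows are equal, the lowered entry coincides with its neighbour and the term vanishes.
D-β : ∀ d {φ lam} → Alternating φ → IsPartition lam → length lam ≤ d →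
  D φ (β d lam) ≡ ∑ (φ ∘ β d) (removeBox lam)
D-β d {φ} {[]} alt part len = D-β-[] d alt
D-β d {lam = zero ∷ lam} alt (() ∷ _ , _) len
-- Here `removeBox` deletes the emptied row; the zero padding in `β` gives it the same entry `d`.
D-β (suc d) {φ} {suc zero ∷ []} alt part len =
  cong₂ ℤ._+_ (ℤ.*-identityˡ (φ (d ∷ β d []))) (D-β-[] d (alt ∘ there {1 + d}))
D-β (suc d) {φ} {suc (suc a) ∷ []} alt part len =
  cong₂ ℤ._+_ (ℤ.*-identityˡ (φ (suc a + d ∷ β d []))) (D-β-[] d (alt ∘ there {2 + a + d}))
D-β (suc zero) {φ} {suc a ∷ b ∷ rest} alt part (s≤s ())
D-β (suc (suc d)) {φ} {suc a ∷ b ∷ rest} alt (_ ∷ pos , b≤1+a ∷ linked) (s≤s len) = begin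
  1ℤ ℤ.* φ (a + suc d ∷ β (suc d) (b ∷ rest)) ℤ.+ D (φ ∘ (suc a + suc d ∷_)) (β (suc d) (b ∷ rest))
    ≡⟨ cong₂ ℤ._+_ (ℤ.*-identityˡ (φ (a + suc d ∷ b + d ∷ β d rest)))
         (D-β (suc d) (alt ∘ there {suc a + suc d}) (pos , linked) len) ⟩
  φ (a + suc d ∷ b + d ∷ β d rest) ℤ.+ ∑ (φ ∘ (suc a + suc d ∷_) ∘ β (suc d)) (removeBox (b ∷ rest))
    ≡⟨ cong₂ ℤ._+_ first (sym (∑-map (φ ∘ β (suc (suc d))) (suc a ∷_) (removeBox (b ∷ rest)))) ⟩
  ∑ (φ ∘ β (suc (suc d))) head-removed ℤ.+ ∑ (φ ∘ β (suc (suc d))) (map (suc a ∷_) (removeBox (b ∷ rest)))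
    ≡⟨ ∑-++ (φ ∘ β (suc (suc d))) head-removed _ ⟨
  ∑ (φ ∘ β (suc (suc d))) (removeBox (suc a ∷ b ∷ rest)) ∎
  where
  open ≡-Reasoning
  head-removed : List (List ℕ)
  head-removed = if b <ᵇ suc a then [ a ∷ b ∷ rest ] else []

  first : φ (a + suc d ∷ b + d ∷ β d rest) ≡ ∑ (φ ∘ β (suc (suc d))) head-removed
  first with b <ᵇ suc a in b<1+a
  ... | true  = sym (ℤ.+-identityʳ _)
  ... | false = trans (cong (λ x → φ (x ∷ b + d ∷ β d rest)) a+1+d≡b+d) (alternating-≡0 alt (b + d) (β d rest))
    where
    b≡1+a : b ≡ suc a
    b≡1+a = ℕ.≤-antisym b≤1+a (ℕ.≮⇒≥ λ lt → subst T b<1+a (ℕ.<⇒<ᵇ lt))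
    a+1+d≡b+d : a + suc d ≡ b + d
    a+1+d≡b+d = trans (ℕ.+-suc a d) (cong (_+ d) (sym b≡1+a))

BoxRemoved : List ℕ → List ℕ → Set
BoxRemoved lam mu = IsPartition mu × length mu ≤ length lam × suc (sum mu) ≡ sum lam

-- The row `c` in front strengthens the induction: when a box leaves the tail, the row above must
-- still be at least as long as the new first row of the tail.
removeBox-bounded : ∀ {c} lam → All (0 <_) lam → Linked _≥ℕ_ (c ∷ lam) →
  All (λ mu → All (0 <_) mu × Linked _≥ℕ_ (c ∷ mu) × length mu ≤ length lam × suc (sum mu) ≡ sum lam)
    (removeBox lam)
removeBox-bounded [] pos linked = []
removeBox-bounded (zero ∷ lam) (() ∷ _) linked
removeBox-bounded (suc zero ∷ []) pos linked = ([] , [-] , z≤n , refl) ∷ []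
removeBox-bounded (suc (suc a) ∷ []) pos (a≤c ∷ [-]) =
  (s≤s z≤n ∷ [] , ℕ.<⇒≤ a≤c ∷ [-] , ℕ.≤-refl , refl) ∷ []
removeBox-bounded {c} (suc a ∷ b ∷ rest) (pa ∷ pb ∷ pos) (a≤c ∷ b≤a ∷ linked) =
  All.++⁺ from-head (All.map⁺ (All.map
    (λ {mu} (p , l , n , s) →
      pa ∷ p , a≤c ∷ l , s≤s n , trans (sym (ℕ.+-suc (suc a) (sum mu))) (cong (_+_ (suc a)) s))
    (removeBox-bounded (b ∷ rest) (pb ∷ pos) (b≤a ∷ linked))))
  where
  from-head : All _ (if b <ᵇ suc a then [ a ∷ b ∷ rest ] else [])
  from-head with b <ᵇ suc a in b<1+a
  ... | false = []
  ... | true  =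
    (ℕ.<-≤-trans pb b≤a′ ∷ pb ∷ pos , ℕ.<⇒≤ a≤c ∷ b≤a′ ∷ linked , ℕ.≤-refl , refl) ∷ []
    where
    b≤a′ : b ≤ a
    b≤a′ = ℕ.≤-pred (ℕ.<ᵇ⇒< b (suc a) (subst T (sym b<1+a) tt))

removeBox-removed : ∀ {lam} → IsPartition lam → All (BoxRemoved lam) (removeBox lam)
removeBox-removed {[]} part = []
removeBox-removed {a ∷ lam} (pos , linked) =
  All.map (λ { (p , _ ∷ l , n , s) → (p , l) , n , s ; (p , [-] , n , s) → (p , []) , n , s })
    (removeBox-bounded {a} (a ∷ lam) pos (ℕ.≤-refl ∷ linked))

-- Minors listed with multiplicity, once for each order of removing the boxes.

minors : ℕ → List ℕ → List (List ℕ)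
minors zero    lam = [ lam ]
minors (suc k) lam = concatMap (minors k) (removeBox lam)

minors-partition : ∀ k {lam} → IsPartition lam →
  All (λ mu → IsPartition mu × k + sum mu ≡ sum lam) (minors k lam)
minors-partition zero    part = (part , refl) ∷ []
minors-partition (suc k) {lam} part = All.concat⁺ (All.map⁺ (All.map
  (λ { (part′ , _ , s) → All.map (λ (p , e) → p , trans (cong suc e) s) (minors-partition k part′) })
  (removeBox-removed part)))

D^-β : ∀ k d {φ lam} → Alternating φ → IsPartition lam → length lam ≤ d →
  D^ k φ (β d lam) ≡ ∑ (φ ∘ β d) (minors k lam)
D^-β zero    d alt part len = sym (ℤ.+-identityʳ _)
D^-β (suc k) d {φ} {lam} alt part len = begin
  D (D^ k φ) (β d lam)                                 ≡⟨ D-β d (D^-alternating k alt) part len ⟩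
  ∑ (D^ k φ ∘ β d) (removeBox lam)
    ≡⟨ ∑-cong (λ (part′ , len′ , _) → D^-β k d alt part′ (ℕ.≤-trans len′ len)) (removeBox-removed part) ⟩
  ∑ (∑ (φ ∘ β d) ∘ minors k) (removeBox lam)           ≡⟨ ∑-concatMap (φ ∘ β d) (minors k) (removeBox lam) ⟨
  ∑ (φ ∘ β d) (minors (suc k) lam)                     ∎
  where open ≡-Reasoning

-- With no steps left, `chains` is the Kronecker delta.
δ : List ℕ → List ℕ → ℕ
δ = chains 0

δ-refl : ∀ tau → δ tau tau ≡ 1
δ-refl tau with ≡-dec ℕ._≟_ tau tau
... | yes _   = refl
... | no  neq = contradiction refl neq

count : List ℕ → List (List ℕ) → ℕ
count tau mus = sum (map (λ mu → δ mu tau) mus)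

count-++ : ∀ tau xs ys → count tau (xs ++ ys) ≡ count tau xs + count tau ys
count-++ tau []       ys = refl
count-++ tau (x ∷ xs) ys = trans (cong (_+_ (δ x tau)) (count-++ tau xs ys)) (sym (ℕ.+-assoc (δ x tau) _ _))

chains≡count : ∀ k lam tau → chains k lam tau ≡ count tau (minors k lam)
chains≡count zero    lam tau = sym (ℕ.+-identityʳ _)
chains≡count (suc k) lam tau = along (removeBox lam)
  where
  along : ∀ mus → sum (map (λ mu → chains k mu tau) mus) ≡ count tau (concatMap (minors k) mus)
  along []         = refl
  along (mu ∷ mus) = trans (cong₂ _+_ (chains≡count k mu tau) (along mus))
    (sym (count-++ tau (minors k mu) (concatMap (minors k) mus)))

count>0⇒∈ : ∀ tau xs → 0 < count tau xs → tau ∈ xs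
count>0⇒∈ tau (x ∷ xs) lt with ≡-dec ℕ._≟_ x tau
... | yes refl = here refl
... | no  _    = there (count>0⇒∈ tau xs lt)

∈⇒count>0 : ∀ tau xs → 0 < count tau (tau ∷ xs)
∈⇒count>0 tau xs rewrite δ-refl tau = s≤s z≤n

-- Each x in the first list also occurs in the second, and deleting it from both keeps the counts
-- equal. The predicate `P` is there because the counts are known to agree only on partitions of the
-- right size.
∑-count : ∀ {P : List ℕ → Set} (f : List ℕ → ℤ) xs ys → All P xs → All P ys →
  (∀ tau → P tau → count tau xs ≡ count tau ys) → ∑ f xs ≡ ∑ f ys
∑-count f [] [] pxs pys same = refl
∑-count f [] (y ∷ ys) pxs (py ∷ _) same =
  contradiction (subst (0 <_) (sym (same y py)) (∈⇒count>0 y ys)) λ ()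
∑-count f (x ∷ xs) ys (px ∷ pxs) pys same
  with ∈-∃++ (count>0⇒∈ x ys (subst (0 <_) (same x px) (∈⇒count>0 x xs)))
... | us , vs , refl = begin
  f x ℤ.+ ∑ f xs                     ≡⟨ cong (ℤ._+_ (f x)) (∑-count f xs (us ++ vs) pxs pus++vs same′) ⟩
  f x ℤ.+ ∑ f (us ++ vs)             ≡⟨ cong (ℤ._+_ (f x)) (∑-++ f us vs) ⟩
  f x ℤ.+ (∑ f us ℤ.+ ∑ f vs)        ≡⟨ exchange (f x) (∑ f us) (∑ f vs) ⟩
  ∑ f us ℤ.+ (f x ℤ.+ ∑ f vs)        ≡⟨ ∑-++ f us (x ∷ vs) ⟨
  ∑ f (us ++ x ∷ vs)                 ∎
  where
  open ≡-Reasoning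
  exchange : ∀ x y z → x ℤ.+ (y ℤ.+ z) ≡ y ℤ.+ (x ℤ.+ z)
  exchange = solve-∀
  pus++vs = All.++⁺ (All.++⁻ˡ us pys) (All.tail (All.++⁻ʳ us pys))
  same′ : ∀ tau → _ → count tau xs ≡ count tau (us ++ vs)
  same′ tau p = ℕ.+-cancelˡ-≡ (δ x tau) _ _ (begin
    δ x tau + count tau xs                      ≡⟨ same tau p ⟩
    count tau (us ++ x ∷ vs)                    ≡⟨ count-++ tau us (x ∷ vs) ⟩
    count tau us + (δ x tau + count tau vs)     ≡⟨ ℕ.+-assoc (count tau us) _ _ ⟨
    count tau us + δ x tau + count tau vs       ≡⟨ cong (_+ count tau vs) (ℕ.+-comm (count tau us) _) ⟩
    δ x tau + count tau us + count tau vs       ≡⟨ ℕ.+-assoc (δ x tau) _ _ ⟩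
    δ x tau + (count tau us + count tau vs)     ≡⟨ cong (_+_ (δ x tau)) (count-++ tau us vs) ⟨
    δ x tau + count tau (us ++ vs)              ∎)

-- Partitions as strictly decreasing sequences.

β-linked : ∀ d {lam} → IsPartition lam → Linked _>_ (β d lam)
β-linked zero       part = []
β-linked (suc zero) {[]}    part = [-]
β-linked (suc zero) {_ ∷ _} part = [-]
β-linked (suc (suc d)) {[]} part = ℕ.≤-refl ∷ β-linked (suc d) part
β-linked (suc (suc d)) {a ∷ []} (_ ∷ pos , _) = ℕ.m≤n+m (suc d) a ∷ β-linked (suc d) (pos , [])
β-linked (suc (suc d)) {a ∷ b ∷ lam} (_ ∷ pos , b≤a ∷ linked) =
  subst (suc (b + d) ≤_) (sym (ℕ.+-suc a d)) (s≤s (ℕ.+-monoˡ-≤ d b≤a)) ∷ β-linked (suc d) (pos , linked)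

β-decreasing : ∀ d {lam} → IsPartition lam → AllPairs _>_ (β d lam)
β-decreasing d part = Linked⇒AllPairs (flip ℕ.<-trans) (β-linked d part)

length-β : ∀ d lam → length (β d lam) ≡ d
length-β zero    lam       = refl
length-β (suc d) []        = cong suc (length-β d [])
length-β (suc d) (_ ∷ lam) = cong suc (length-β d lam)

-- Parts are positive, so the entry of a genuine row exceeds the entry `d` of a padded one, and
-- padding cannot be mistaken for a row.
β-injective : ∀ d {lam mu} → All (0 <_) lam → All (0 <_) mu → length lam ≤ d → length mu ≤ d →
  β d lam ≡ β d mu → lam ≡ mu
β-injective d {[]} {[]} plam pmu ll lm eq = refl
β-injective (suc d) {[]} {b ∷ mu} plam (pb ∷ pmu) ll lm eq =
  contradiction (∷-injectiveˡ eq) (ℕ.<⇒≢ (ℕ.+-monoˡ-≤ d pb))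
β-injective (suc d) {a ∷ lam} {[]} (pa ∷ plam) pmu ll lm eq =
  contradiction (sym (∷-injectiveˡ eq)) (ℕ.<⇒≢ (ℕ.+-monoˡ-≤ d pa))
β-injective (suc d) {a ∷ lam} {b ∷ mu} (pa ∷ plam) (pb ∷ pmu) (s≤s ll) (s≤s lm) eq =
  cong₂ _∷_ (ℕ.+-cancelʳ-≡ d a b (∷-injectiveˡ eq)) (β-injective d plam pmu ll lm (∷-injectiveʳ eq))

-- The Vandermonde product and positivity.

differences : ℕ → List ℕ → ℤ
differences a []      = 1ℤ
differences a (b ∷ l) = (+ a ℤ.- + b) ℤ.* differences a l

vandermonde : Functional
vandermonde []      = 1ℤ
vandermonde (a ∷ l) = differences a l ℤ.* vandermonde l

differences-≈ₛ : ∀ a {l l′} → l ≈ₛ l′ → differences a l ≡ differences a l′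
differences-≈ₛ a (here {b} {c} {l}) = exchange (+ a ℤ.- + b) (+ a ℤ.- + c) (differences a l)
  where
  exchange : ∀ x y z → x ℤ.* (y ℤ.* z) ≡ y ℤ.* (x ℤ.* z)
  exchange = solve-∀
differences-≈ₛ a (there {b} sw) = cong (ℤ._*_ (+ a ℤ.- + b)) (differences-≈ₛ a sw)

vandermonde-alternating : Alternating vandermonde
vandermonde-alternating (here {a} {b} {l}) =
  exchange (+ a) (+ b) (differences a l) (differences b l) (vandermonde l)
  where
  exchange : ∀ a b x y z → ((a ℤ.- b) ℤ.* x) ℤ.* (y ℤ.* z) ≡ ℤ.- (((b ℤ.- a) ℤ.* y) ℤ.* (x ℤ.* z))
  exchange = solve-∀
vandermonde-alternating (there {a} {l} {l′} sw) =
  trans (cong₂ ℤ._*_ (differences-≈ₛ a sw) (vandermonde-alternating sw))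
        (sym (ℤ.neg-distribʳ-* (differences a l′) (vandermonde l′)))

*-pos : ∀ {i j} → 0ℤ ℤ.< i → 0ℤ ℤ.< j → 0ℤ ℤ.< i ℤ.* j
*-pos (+<+ (s≤s _)) (+<+ (s≤s _)) = +<+ (s≤s z≤n)

vandermonde-pos : ∀ {l} → AllPairs _>_ l → 0ℤ ℤ.< vandermonde l
vandermonde-pos []         = +<+ (s≤s z≤n)
vandermonde-pos (gt ∷ gts) = *-pos (differences-pos gt) (vandermonde-pos gts)
  where
  differences-pos : ∀ {a l} → All (_< a) l → 0ℤ ℤ.< differences a l
  differences-pos []         = +<+ (s≤s z≤n)
  differences-pos {a} {b ∷ l} (lt ∷ lts) = *-pos
    (subst (ℤ._< + a ℤ.- + b) (ℤ.+-inverseʳ (+ b)) (ℤ.+-monoˡ-< (ℤ.- + b) (+<+ lt)))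
    (differences-pos lts)

∑-nonneg : {A : Set} {f : A → ℤ} {xs : List A} → All (λ x → 0ℤ ℤ.< f x) xs → 0ℤ ℤ.≤ ∑ f xs
∑-nonneg []         = ℤ.≤-refl
∑-nonneg (px ∷ pxs) = ℤ.+-mono-≤ (ℤ.<⇒≤ px) (∑-nonneg pxs)

∑-pos : {A : Set} {f : A → ℤ} {xs : List A} → 0 < length xs → All (λ x → 0ℤ ℤ.< f x) xs → 0ℤ ℤ.< ∑ f xs
∑-pos lt (px ∷ pxs) = ℤ.+-mono-<-≤ px (∑-nonneg pxs)

removeBox-nonempty : ∀ {a lam} → All (0 <_) (a ∷ lam) → 0 < length (removeBox (a ∷ lam))
removeBox-nonempty {suc zero}    {[]} pos = s≤s z≤n
removeBox-nonempty {suc (suc a)} {[]} pos = s≤s z≤n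
removeBox-nonempty {a} {b ∷ rest} (_ ∷ pos) with b <ᵇ a
... | true  = s≤s z≤n
... | false = subst (0 <_) (sym (length-map (a ∷_) (removeBox (b ∷ rest)))) (removeBox-nonempty pos)

-- A nonempty partition has a removable box, so every step is a nonempty sum of positive terms. With
-- the Vandermonde product this yields a nonzero factor to cancel.
D^-pos : ∀ k d {φ lam} → Alternating φ → (∀ {mu} → IsPartition mu → 0ℤ ℤ.< φ (β d mu)) →
  IsPartition lam → length lam ≤ d → k ≤ sum lam → 0ℤ ℤ.< D^ k φ (β d lam)
D^-pos zero    d alt pos part len k≤ = pos part
D^-pos (suc k) d {φ} {a ∷ lam} alt pos part len k≤ =
  subst (0ℤ ℤ.<_) (sym (D-β d (D^-alternating k alt) part len))
    (∑-pos (removeBox-nonempty (proj₁ part)) (All.map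
      (λ (part′ , len′ , s) → D^-pos k d alt pos part′ (ℕ.≤-trans len′ len)
        (ℕ.≤-pred (subst (suc k ≤_) (sym s) k≤)))
      (removeBox-removed part)))

-- Degrees of sums, products and powers.

degree-cong : ∀ r {g h} → (∀ a → g a ≡ h a) → Degree≤ r g → Degree≤ r h
degree-cong zero    eq deg a = trans (cong₂ ℤ._-_ (sym (eq (suc a))) (sym (eq a))) (deg a)
degree-cong (suc r) eq deg   = degree-cong r (λ a → cong₂ ℤ._-_ (eq (suc a)) (eq a)) deg

degree-zero : ∀ r → Degree≤ r (λ _ → 0ℤ)
degree-zero zero    a = refl
degree-zero (suc r)   = degree-zero r

degree-const : ∀ r c → Degree≤ r (λ _ → c)
degree-const zero    c a = ℤ.+-inverseʳ c
degree-const (suc r) c   = degree-cong r (λ _ → sym (ℤ.+-inverseʳ c)) (degree-zero r)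

degree-+ : ∀ r {g h} → Degree≤ r g → Degree≤ r h → Degree≤ r (λ a → g a ℤ.+ h a)
degree-+ zero {g} {h} dg dh a =
  trans (regroup (g (suc a)) (h (suc a)) (g a) (h a)) (cong₂ ℤ._+_ (dg a) (dh a))
  where
  regroup : ∀ x y z w → (x ℤ.+ y) ℤ.- (z ℤ.+ w) ≡ (x ℤ.- z) ℤ.+ (y ℤ.- w)
  regroup = solve-∀
degree-+ (suc r) {g} {h} dg dh =
  degree-cong r (λ a → regroup (g (suc a)) (h (suc a)) (g a) (h a)) (degree-+ r dg dh)
  where
  regroup : ∀ x y z w → (x ℤ.- z) ℤ.+ (y ℤ.- w) ≡ (x ℤ.+ y) ℤ.- (z ℤ.+ w)
  regroup = solve-∀

degree-∘suc : ∀ r {g} → Degree≤ r g → Degree≤ r (g ∘ suc)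
degree-∘suc zero    deg a = deg (suc a)
degree-∘suc (suc r) deg   = degree-∘suc r deg

Δ-* : ∀ g h a → Δ g a ℤ.* h (suc a) ℤ.+ g a ℤ.* Δ h a ≡ Δ (λ a → g a ℤ.* h a) a
Δ-* g h a = leibniz (g (suc a)) (g a) (h (suc a)) (h a)
  where
  leibniz : ∀ x y z w → (x ℤ.- y) ℤ.* z ℤ.+ y ℤ.* (z ℤ.- w) ≡ x ℤ.* z ℤ.- y ℤ.* w
  leibniz = solve-∀

-- By the Leibniz rule `Δ-*`, the difference of the product is a sum of two products, in each of
-- which one factor has been differenced.
degree-* : ∀ r s {g h} → Degree≤ r g → Degree≤ s h → Degree≤ (r + s) (λ a → g a ℤ.* h a)
degree-* zero zero {g} {h} dg dh a = begin
  Δ (λ a → g a ℤ.* h a) a                       ≡⟨ Δ-* g h a ⟨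
  Δ g a ℤ.* h (suc a) ℤ.+ g a ℤ.* Δ h a
    ≡⟨ cong₂ ℤ._+_ (cong (ℤ._* h (suc a)) (dg a)) (cong (ℤ._*_ (g a)) (dh a)) ⟩
  0ℤ ℤ.+ g a ℤ.* 0ℤ                             ≡⟨ trans (ℤ.+-identityˡ _) (ℤ.*-zeroʳ (g a)) ⟩
  0ℤ                                            ∎
  where open ≡-Reasoning
degree-* zero (suc s) {g} {h} dg dh = degree-cong s (Δ-* g h) (degree-+ s
  (degree-cong s (λ a → sym (cong (ℤ._* h (suc a)) (dg a))) (degree-zero s))
  (degree-* zero s {g} {Δ h} dg dh))
degree-* (suc r) zero {g} {h} dg dh = degree-cong (r + 0) (Δ-* g h) (degree-+ (r + 0)
  (degree-* r zero {Δ g} {h ∘ suc} dg (degree-∘suc zero {h} dh))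
  (degree-cong (r + 0) (λ a → sym (trans (cong (ℤ._*_ (g a)) (dh a)) (ℤ.*-zeroʳ (g a)))) (degree-zero (r + 0))))
degree-* (suc r) (suc s) {g} {h} dg dh = degree-cong (r + suc s) (Δ-* g h) (degree-+ (r + suc s)
  (degree-* r (suc s) {Δ g} {h ∘ suc} dg (degree-∘suc (suc s) {h} dh))
  (subst (λ t → Degree≤ t (λ a → g a ℤ.* Δ h a)) (sym (ℕ.+-suc r s))
    (degree-* (suc r) s {g} {Δ h} dg dh)))

degree-^ : ∀ r e {g} → Degree≤ r g → Degree≤ (e * r) (λ a → g a ℤ.^ e)
degree-^ r zero    deg = degree-const 0 1ℤ
degree-^ r (suc e) {g} deg = degree-* r (e * r) deg (degree-^ r e {g} deg)

-- Integer-scaled Chebyshev polynomials.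

∣i^n∣≡∣i∣^n : ∀ i n → ∣ i ℤ.^ n ∣ ≡ ∣ i ∣ ^ n
∣i^n∣≡∣i∣^n i zero    = refl
∣i^n∣≡∣i∣^n i (suc n) = trans (ℤ.abs-* i (i ℤ.^ n)) (cong (_*_ ∣ i ∣) (∣i^n∣≡∣i∣^n i n))

i*i≡+∣i∣*∣i∣ : ∀ i → i ℤ.* i ≡ + (∣ i ∣ * ∣ i ∣)
i*i≡+∣i∣*∣i∣ (+ n)    = sym (ℤ.pos-* n n)
i*i≡+∣i∣*∣i∣ -[1+ n ] = refl

-- Both the affine start w - 2 (c - i) of `cheb` and, up to sign, its recursion W² - 2 q² have this
-- form.
∣m-2n∣≤m : ∀ {m n} → n ≤ m → ∣ + m ℤ.- + 2 ℤ.* + n ∣ ≤ m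
∣m-2n∣≤m {m} {n} n≤m rewrite sym (ℤ.pos-* 2 n) | ℤ.m-n≡m⊖n m (2 * n) with ℕ.≤-total (2 * n) m
... | inj₁ 2n≤m rewrite ℤ.⊖-≥ 2n≤m = ℕ.m∸n≤m m (2 * n)
... | inj₂ m≤2n rewrite ℤ.∣⊖∣-≤ m≤2n =
  ℕ.m≤n+o⇒m∸n≤o (2 * n) m (ℕ.+-mono-≤ n≤m (subst (_≤ m) (sym (ℕ.+-identityʳ n)) n≤m))

-- cheb s = W T(cheb 0 / w), where W = scale s = w^(2^s) and T is the Chebyshev polynomial of degree
-- 2^s, since T₂ₙ = 2 Tₙ² − 1. The affine cheb 0 maps [c − w , c] onto [− w , w].
module Chebyshev (w c : ℕ) where

  scale : ℕ → ℕ
  scale zero    = w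
  scale (suc s) = scale s * scale s

  -- The amount by which `cheb s` exceeds `scale s` at `suc c`, one step outside the interval. The
  -- recursion comes from 2 (W + U)² - W² = W² + (4 W U + 2 U²).
  excess : ℕ → ℕ
  excess zero    = 2
  excess (suc s) = 4 * (scale s * excess s) + 2 * (excess s * excess s)

  cheb : ℕ → ℕ → ℤ
  cheb zero    i = + w ℤ.- + 2 ℤ.* (+ c ℤ.- + i)
  cheb (suc s) i = + 2 ℤ.* (cheb s i ℤ.* cheb s i) ℤ.- + (scale s * scale s)

  cheb-degree : ∀ s → Degree≤ (2 ^ s) (cheb s)
  cheb-degree zero = degree-cong 0 (λ a → sym (slope (+ w) (+ c) (+ a))) (degree-const 0 (+ 2))
    where
    slope : ∀ w c a → (w ℤ.- + 2 ℤ.* (c ℤ.- (1ℤ ℤ.+ a))) ℤ.- (w ℤ.- + 2 ℤ.* (c ℤ.- a)) ≡ + 2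
    slope = solve-∀
  cheb-degree (suc s) = degree-+ (2 * 2 ^ s) {λ i → + 2 ℤ.* q² i}
    (degree-* 0 (2 * 2 ^ s) {λ _ → + 2} (degree-const 0 (+ 2))
      (subst (λ r → Degree≤ r q²) (cong (_+_ (2 ^ s)) (sym (ℕ.+-identityʳ (2 ^ s))))
        (degree-* (2 ^ s) (2 ^ s) (cheb-degree s) (cheb-degree s))))
    (degree-const (2 * 2 ^ s) (ℤ.- + (scale s * scale s)))
    where
    q² : ℕ → ℤ
    q² i = cheb s i ℤ.* cheb s i

  -- As c ≤ w, the interval [0 , c] lies in [c - w , c]. From |q| ≤ W follows 0 ≤ q² ≤ W², hence |W²
  -- - 2 q²| ≤ W².
  cheb-bounded : c ≤ w → ∀ s {i} → i ≤ c → ∣ cheb s i ∣ ≤ scale s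
  cheb-bounded c≤w zero {i} i≤c =
    subst (λ x → ∣ + w ℤ.- + 2 ℤ.* x ∣ ≤ w) (sym (trans (ℤ.m-n≡m⊖n c i) (ℤ.⊖-≥ i≤c)))
      (∣m-2n∣≤m (ℕ.≤-trans (ℕ.m∸n≤m c i) c≤w))
  cheb-bounded c≤w (suc s) {i} i≤c =
    subst (_≤ scale s * scale s)
      (trans (ℤ.∣i-j∣≡∣j-i∣ (+ (scale s * scale s)) (+ 2 ℤ.* + (∣ q ∣ * ∣ q ∣)))
        (cong (λ x → ∣ + 2 ℤ.* x ℤ.- + (scale s * scale s) ∣) (sym (i*i≡+∣i∣*∣i∣ q))))
      (∣m-2n∣≤m (ℕ.*-mono-≤ bound bound))
    where
    q = cheb s i
    bound = cheb-bounded c≤w s i≤c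

  cheb-next : ∀ s → cheb s (suc c) ≡ + (scale s + excess s)
  cheb-next zero = trans (next (+ w) (+ c)) refl
    where
    next : ∀ w c → w ℤ.- + 2 ℤ.* (c ℤ.- (1ℤ ℤ.+ c)) ≡ w ℤ.+ + 2
    next = solve-∀
  cheb-next (suc s) rewrite cheb-next s = begin
    + 2 ℤ.* ((+ W ℤ.+ + U) ℤ.* (+ W ℤ.+ + U)) ℤ.- + (W * W)
      ≡⟨ cong (λ x → + 2 ℤ.* ((+ W ℤ.+ + U) ℤ.* (+ W ℤ.+ + U)) ℤ.- x) (ℤ.pos-* W W) ⟩
    + 2 ℤ.* ((+ W ℤ.+ + U) ℤ.* (+ W ℤ.+ + U)) ℤ.- + W ℤ.* + W
      ≡⟨ expand (+ W) (+ U) ⟩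
    + W ℤ.* + W ℤ.+ (+ 4 ℤ.* (+ W ℤ.* + U) ℤ.+ + 2 ℤ.* (+ U ℤ.* + U))
      ≡⟨ cong₂ ℤ._+_ (ℤ.pos-* W W) (cong₂ ℤ._+_
           (trans (ℤ.pos-* 4 (W * U)) (cong (ℤ._*_ (+ 4)) (ℤ.pos-* W U)))
           (trans (ℤ.pos-* 2 (U * U)) (cong (ℤ._*_ (+ 2)) (ℤ.pos-* U U)))) ⟨
    + (W * W + (4 * (W * U) + 2 * (U * U))) ∎
    where
    W = scale s
    U = excess s
    open ≡-Reasoning
    expand : ∀ w u → + 2 ℤ.* ((w ℤ.+ u) ℤ.* (w ℤ.+ u)) ℤ.- w ℤ.* w
      ≡ w ℤ.* w ℤ.+ (+ 4 ℤ.* (w ℤ.* u) ℤ.+ + 2 ℤ.* (u ℤ.* u))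
    expand = solve-∀

  -- Dropping 2 U² shows that the ratio U / W at least quadruples at each step, starting from 2 / w.
  -- This is the tangent bound at 1, where the Chebyshev polynomial of degree N = 2^s has slope N² =
  -- 4^s.
  excess-growth : ∀ s → 2 * 4 ^ s * scale s ≤ w * excess s
  excess-growth zero    = ℕ.≤-reflexive (ℕ.*-comm 2 w)
  excess-growth (suc s) = begin
    2 * (4 * 4 ^ s) * (W * W)             ≡⟨ left (4 ^ s) W ⟩
    4 * W * (2 * 4 ^ s * W)               ≤⟨ ℕ.*-monoʳ-≤ (4 * W) (excess-growth s) ⟩
    4 * W * (w * U)                       ≡⟨ right W w U ⟩
    w * (4 * (W * U))                     ≤⟨ ℕ.*-monoʳ-≤ w (ℕ.m≤m+n (4 * (W * U)) (2 * (U * U))) ⟩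
    w * (4 * (W * U) + 2 * (U * U))       ∎
    where
    open ℕ.≤-Reasoning
    W = scale s
    U = excess s
    left : ∀ x y → 2 * (4 * x) * (y * y) ≡ 4 * y * (2 * x * y)
    left = ℕ-Solver.solve-∀
    right : ∀ x y z → 4 * x * (y * z) ≡ y * (4 * (x * z))
    right = ℕ-Solver.solve-∀

  -- A degree 2^s of order √w thus doubles the value one step outside the interval.
  2*scale≤∣cheb∣ : 0 < w → ∀ s → w ≤ 2 * 4 ^ s → 2 * scale s ≤ ∣ cheb s (suc c) ∣
  2*scale≤∣cheb∣ (s≤s _) s w≤2·4^s rewrite cheb-next s = ℕ.+-monoʳ-≤ (scale s)
    (subst (_≤ excess s) (sym (ℕ.+-identityʳ (scale s)))
      (ℕ.*-cancelˡ-≤ w (ℕ.≤-trans (ℕ.*-monoˡ-≤ (scale s) w≤2·4^s) (excess-growth s))))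

  scale-pos : 0 < w → ∀ s → 0 < scale s
  scale-pos 0<w zero    = 0<w
  scale-pos 0<w (suc s) = ℕ.*-mono-< (scale-pos 0<w s) (scale-pos 0<w s)

-- Separation of decreasing sequences by sums of polynomial values.

∣∑∣-bounded : ∀ {A : Set} {g : A → ℤ} {M} {l} → All (λ i → ∣ g i ∣ ≤ M) l → ∣ ∑ g l ∣ ≤ length l * M
∣∑∣-bounded [] = z≤n
∣∑∣-bounded {g = g} {l = i ∷ l} (le ∷ les) =
  ℕ.≤-trans (ℤ.∣i+j∣≤∣i∣+∣j∣ (g i) (∑ g l)) (ℕ.+-mono-≤ le (∣∑∣-bounded les))

^-distribʳ-* : ∀ e m n → (m * n) ^ e ≡ m ^ e * n ^ e
^-distribʳ-* zero    m n = refl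
^-distribʳ-* (suc e) m n =
  trans (cong (_*_ (m * n)) (^-distribʳ-* e m n)) (ℕ.[m*n]*[o*p]≡[m*o]*[n*p] m n (m ^ e) (n ^ e))

-- Take the e-th power of `cheb s`. At `suc c` it is at least 2^e M in absolute value, while all
-- other entries together contribute at most (length xs + length ys) M, which is smaller.
separate : ∀ {w e s c} → 0 < w → w ≤ 2 * 4 ^ s → c ≤ w → ∀ {xs ys} →
  All (_≤ c) xs → All (_≤ c) ys → length xs + length ys < 2 ^ e →
  ¬ (∀ g → Degree≤ (e * 2 ^ s) g → ∑ g (suc c ∷ xs) ≡ ∑ g ys)
separate {w} {e} {s} {c} 0<w w≤ c≤w {xs} {ys} xs≤c ys≤c len same = ℕ.<-irrefl refl (begin-strict
  (length xs + length ys) * M           <⟨ ℕ.*-monoˡ-< M {{>-nonZero M>0}} len ⟩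
  2 ^ e * M                             ≡⟨ ^-distribʳ-* e 2 (scale s) ⟨
  (2 * scale s) ^ e                     ≤⟨ ℕ.^-monoˡ-≤ e (2*scale≤∣cheb∣ 0<w s w≤) ⟩
  ∣ cheb s (suc c) ∣ ^ e                ≡⟨ ∣i^n∣≡∣i∣^n (cheb s (suc c)) e ⟨
  ∣ g (suc c) ∣                         ≡⟨ cong ∣_∣ isolate ⟩
  ∣ ∑ g ys ℤ.- ∑ g xs ∣                 ≤⟨ ℤ.∣i-j∣≤∣i∣+∣j∣ (∑ g ys) (∑ g xs) ⟩
  ∣ ∑ g ys ∣ + ∣ ∑ g xs ∣               ≤⟨ ℕ.+-mono-≤ (∣∑∣-bounded (All.map bounded ys≤c))
                                                      (∣∑∣-bounded (All.map bounded xs≤c)) ⟩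
  length ys * M + length xs * M         ≡⟨ ℕ.*-distribʳ-+ M (length ys) (length xs) ⟨
  (length ys + length xs) * M           ≡⟨ cong (_* M) (ℕ.+-comm (length ys) (length xs)) ⟩
  (length xs + length ys) * M           ∎)
  where
  open ℕ.≤-Reasoning
  open Chebyshev w c
  M = scale s ^ e
  M>0 : 0 < M
  M>0 = ℕ.m^n>0 (scale s) {{>-nonZero (scale-pos 0<w s)}} e
  g : ℕ → ℤ
  g i = cheb s i ℤ.^ e
  bounded : ∀ {i} → i ≤ c → ∣ g i ∣ ≤ M
  bounded {i} i≤c = subst (_≤ M) (sym (∣i^n∣≡∣i∣^n (cheb s i) e)) (ℕ.^-monoˡ-≤ e (cheb-bounded c≤w s i≤c))
  cancel : ∀ x y → x ≡ (x ℤ.+ y) ℤ.- y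
  cancel = solve-∀
  isolate : g (suc c) ≡ ∑ g ys ℤ.- ∑ g xs
  isolate = trans (cancel (g (suc c)) (∑ g xs))
    (cong (ℤ._- ∑ g xs) (same g (degree-^ (2 ^ s) e (cheb-degree s))))

power-sums-injective : ∀ {w e s} → 0 < w → w ≤ 2 * 4 ^ s → ∀ {xs ys} →
  AllPairs _>_ xs → AllPairs _>_ ys → All (_≤ w) xs → All (_≤ w) ys →
  length xs ≡ length ys → length xs + length ys ≤ 2 ^ e →
  (∀ g → Degree≤ (e * 2 ^ s) g → ∑ g xs ≡ ∑ g ys) → xs ≡ ys
power-sums-injective 0<w w≤ {[]} {[]} gx gy bx by len size same = refl
power-sums-injective {w} {e} {s} 0<w w≤ {x ∷ xs} {y ∷ ys}
  (x> ∷ gx) (y> ∷ gy) (x≤w ∷ bx) (y≤w ∷ by) len size same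
  with ℕ.<-cmp x y
... | tri≈ _ refl _ = cong (x ∷_) (power-sums-injective {w} {e} {s} 0<w w≤ gx gy bx by
  (ℕ.suc-injective len) (ℕ.≤-trans (ℕ.+-mono-≤ (ℕ.n≤1+n _) (ℕ.n≤1+n _)) size)
  (λ g deg → ∙-cancelˡ ℤ.+-0-abelianGroup (g x) (∑ g xs) (∑ g ys) (same g deg)))
-- The match writes x as `suc c`, and c bounds all remaining entries of both sequences. Setting x
-- apart makes the size bound strict.
... | tri> _ _ x>y@(s≤s y≤c) = contradiction same
  (separate {w} {e} {s} 0<w w≤ (ℕ.<⇒≤ x≤w) (All.map ℕ.≤-pred x>)
    (y≤c ∷ All.map (λ lt → ℕ.<⇒≤ (ℕ.<-≤-trans lt y≤c)) y>) size)
... | tri< x<y@(s≤s x≤c) _ _ = contradiction (λ g deg → sym (same g deg))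
  (separate {w} {e} {s} 0<w w≤ (ℕ.<⇒≤ y≤w) (All.map ℕ.≤-pred y>)
    (x≤c ∷ All.map (λ lt → ℕ.<⇒≤ (ℕ.<-≤-trans lt x≤c)) x>)
    (subst (λ t → suc t ≤ 2 ^ e) (ℕ.+-comm (suc (length xs)) (length ys))
      (subst (λ t → suc t ≤ 2 ^ e) (ℕ.+-suc (length xs) (length ys)) size)))

-- From the minors to the polynomial sums and to the partition.

β-bounded : ∀ d lam → All (_≤ sum lam + d) (β d lam)
β-bounded zero    lam = []
β-bounded (suc d) [] = ℕ.n≤1+n d ∷ All.map (λ le → ℕ.≤-trans le (ℕ.n≤1+n d)) (β-bounded d [])
β-bounded (suc d) (a ∷ lam) =
  ℕ.+-mono-≤ (ℕ.m≤m+n a (sum lam)) (ℕ.n≤1+n d)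
  ∷ All.map (λ le → ℕ.≤-trans le (ℕ.+-mono-≤ (ℕ.m≤n+m (sum lam) a) (ℕ.n≤1+n d))) (β-bounded d lam)

length≤sum : ∀ {lam} → All (0 <_) lam → length lam ≤ sum lam
length≤sum []         = z≤n
length≤sum (pa ∷ pos) = ℕ.+-mono-≤ pa (length≤sum pos)

length≤n : ∀ {n lam} → IsPartitionOf n lam → length lam ≤ n
length≤n {lam = lam} ((pos , _) , s) = subst (length lam ≤_) s (length≤sum pos)

module _ {m k : ℕ} {lam mu : List ℕ}
  (partλ : IsPartitionOf (k + m) lam) (partμ : IsPartitionOf (k + m) mu)
  (same : ∀ tau → IsPartitionOf m tau → chains k lam tau ≡ chains k mu tau) where

  private
    n = k + m

    minors-of-size : ∀ {nu} → IsPartitionOf n nu → All (IsPartitionOf m) (minors k nu)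
    minors-of-size (part , s) =
      All.map (λ (p , e) → p , ℕ.+-cancelˡ-≡ k _ _ (trans e s)) (minors-partition k part)

  D^-agree : ∀ {χ} → Alternating χ → D^ k χ (β n lam) ≡ D^ k χ (β n mu)
  D^-agree {χ} alt = begin
    D^ k χ (β n lam)            ≡⟨ D^-β k n alt (proj₁ partλ) (length≤n partλ) ⟩
    ∑ (χ ∘ β n) (minors k lam)  ≡⟨ ∑-count (χ ∘ β n) _ _ (minors-of-size partλ)
                                     (minors-of-size partμ) same-count ⟩
    ∑ (χ ∘ β n) (minors k mu)   ≡⟨ D^-β k n alt (proj₁ partμ) (length≤n partμ) ⟨
    D^ k χ (β n mu)             ∎
    where
    open ≡-Reasoning
    same-count : ∀ tau → IsPartitionOf m tau → count tau (minors k lam) ≡ count tau (minors k mu)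
    same-count tau part =
      trans (sym (chains≡count k lam tau)) (trans (same tau part) (chains≡count k mu tau))

  -- Both F = D^n V and its product with the sum of g are D^k of an alternating function, so each
  -- takes equal values at the two sequences. F is positive at `β n lam` and cancels.
  power-sums-agree : ∀ g → Degree≤ m g → ∑ g (β n lam) ≡ ∑ g (β n mu)
  power-sums-agree g deg with lower-D^ m k 0 deg vandermonde-alternating
  ... | χ , altχ , lower≗ = ℤ.*-cancelʳ-≡ _ _ (F (β n lam)) {{ℤ.>-nonZero F>0}} (begin
    ∑ g (β n lam) ℤ.* F (β n lam)   ≡⟨ lower-0 g F (β n lam) ⟨
    lower g 0 F (β n lam)           ≡⟨ lower≗ (β n lam) ⟩
    D^ k χ (β n lam)                ≡⟨ D^-agree altχ ⟩
    D^ k χ (β n mu)                 ≡⟨ lower≗ (β n mu) ⟨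
    lower g 0 F (β n mu)            ≡⟨ lower-0 g F (β n mu) ⟩
    ∑ g (β n mu) ℤ.* F (β n mu)     ≡⟨ cong (ℤ._*_ (∑ g (β n mu))) F-agree ⟨
    ∑ g (β n mu) ℤ.* F (β n lam)    ∎)
    where
    open ≡-Reasoning
    F : Functional
    F = D^ n vandermonde
    F>0 : 0ℤ ℤ.< F (β n lam)
    F>0 = D^-pos n n vandermonde-alternating (vandermonde-pos ∘ β-decreasing n)
      (proj₁ partλ) (length≤n partλ) (ℕ.≤-reflexive (sym (proj₂ partλ)))
    F-agree : F (β n lam) ≡ F (β n mu)
    F-agree = trans (D^-D^ k m vandermonde (β n lam))
      (trans (D^-agree (D^-alternating m vandermonde-alternating)) (sym (D^-D^ k m vandermonde (β n mu))))

reconstructible : ∀ k e s → let n = k + e * 2 ^ s in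
  0 < n → n ≤ 4 ^ s → n + n ≤ 2 ^ e → MultisetReconstructible n k
reconstructible k e s 0<n n≤4^s 2n≤2^e lam mu partλ@((posλ , _) , sumλ) partμ@((posμ , _) , sumμ) sameN =
  β-injective n posλ posμ (length≤n partλ) (length≤n partμ)
    -- Each sequence has n entries in [0 , 2n], hence w = 2n, and there are 2n ≤ 2^e entries in all.
    (power-sums-injective {n + n} {e} {s} (ℕ.<-≤-trans 0<n (ℕ.m≤m+n n n)) 2n≤2·4^s
      (β-decreasing n (proj₁ partλ)) (β-decreasing n (proj₁ partμ))
      (β≤2n {lam} sumλ) (β≤2n {mu} sumμ)
      (trans (length-β n lam) (sym (length-β n mu)))
      (subst (_≤ 2 ^ e) (sym (cong₂ _+_ (length-β n lam) (length-β n mu))) 2n≤2^e)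
      (power-sums-agree partλ partμ same))
  where
  m = e * 2 ^ s
  n = k + m
  2n≤2·4^s : n + n ≤ 2 * 4 ^ s
  2n≤2·4^s = ℕ.+-mono-≤ n≤4^s (subst (n ≤_) (sym (ℕ.+-identityʳ (4 ^ s))) n≤4^s)
  β≤2n : ∀ {nu} → sum nu ≡ n → All (_≤ n + n) (β n nu)
  β≤2n {nu} s = subst (λ t → All (_≤ t + n) (β n nu)) s (β-bounded n nu)
  same : ∀ tau → IsPartitionOf m tau → chains k lam tau ≡ chains k mu tau
  same tau (part , s) = begin
    chains k lam tau                     ≡⟨ cong (λ j → chains j lam tau) (steps {lam} sumλ) ⟨
    N lam tau                            ≡⟨ sameN tau (part , trans s (sym (ℕ.m+n∸m≡n k m))) ⟩
    N mu tau                             ≡⟨ cong (λ j → chains j mu tau) (steps {mu} sumμ) ⟩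
    chains k mu tau                      ∎
    where
    open ≡-Reasoning
    steps : ∀ {nu} → sum nu ≡ n → sum nu ∸ sum tau ≡ k
    steps s′ = trans (cong₂ _∸_ s′ s) (ℕ.m+n∸n≡m k m)

-- Numerical estimates for the degree, and the asymptotics.

n<2^[1+⌊log₂n⌋] : ∀ n → n < 2 ^ suc ⌊log₂ n ⌋
n<2^[1+⌊log₂n⌋] n = ℕ.≰⇒> λ le → ℕ.<-irrefl refl
  (subst (_≤ ⌊log₂ n ⌋) (⌊log₂[2^n]⌋≡n (suc ⌊log₂ n ⌋)) (⌊log₂⌋-mono-≤ le))

2^⌊log₂n⌋≤2n : ∀ n → 0 < n → 2 ^ ⌊log₂ n ⌋ ≤ 2 * n
2^⌊log₂n⌋≤2n n@(suc _) 0<n = ℕ.<⇒≤ (ℕ.≰⇒> λ le → ℕ.<-irrefl refl (begin-strict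
  ⌊log₂ n ⌋               <⟨ ℕ.n<1+n ⌊log₂ n ⌋ ⟩
  suc ⌊log₂ n ⌋           ≡⟨ ⌊log₂[2*b]⌋≡1+⌊log₂b⌋ n ⟨
  ⌊log₂ 2 * n ⌋           ≤⟨ ⌊log₂⌋-mono-≤ le ⟩
  ⌊log₂ 2 ^ ⌊log₂ n ⌋ ⌋   ≡⟨ ⌊log₂[2^n]⌋≡n ⌊log₂ n ⌋ ⟩
  ⌊log₂ n ⌋               ∎))
  where open ℕ.≤-Reasoning

-- Equality holds at h = 0, and twice the quadratic at h exceeds the quadratic at h + 1 by exactly 8
-- h².
quadratic≤24*2^ : ∀ h → 8 * (h * h) + 16 * h + 24 ≤ 24 * 2 ^ h
quadratic≤24*2^ zero    = ℕ.≤-refl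
quadratic≤24*2^ (suc h) = begin
  8 * (suc h * suc h) + 16 * suc h + 24              ≡⟨ expand h ⟩
  8 * (h * h) + 32 * h + 48                          ≤⟨ ℕ.m≤m+n _ (8 * (h * h)) ⟩
  8 * (h * h) + 32 * h + 48 + 8 * (h * h)            ≡⟨ double h ⟩
  2 * (8 * (h * h) + 16 * h + 24)                    ≤⟨ ℕ.*-monoʳ-≤ 2 (quadratic≤24*2^ h) ⟩
  2 * (24 * 2 ^ h)                                   ≡⟨ swap (2 ^ h) ⟩
  24 * (2 * 2 ^ h)                                   ∎
  where
  open ℕ.≤-Reasoning
  expand : ∀ h → 8 * (suc h * suc h) + 16 * suc h + 24 ≡ 8 * (h * h) + 32 * h + 48
  expand = ℕ-Solver.solve-∀
  double : ∀ h → 8 * (h * h) + 32 * h + 48 + 8 * (h * h) ≡ 2 * (8 * (h * h) + 16 * h + 24)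
  double = ℕ-Solver.solve-∀
  swap : ∀ x → 2 * (24 * x) ≡ 24 * (2 * x)
  swap = ℕ-Solver.solve-∀

-- The degree e 2^s of the test polynomial, for e = L + 2 and s = ⌊L/2⌋ + 1.
retained : ℕ → ℕ
retained L = (L + 2) * 2 ^ suc (L / 2)

⌊n/2⌋-upper : ∀ L → L ≤ 1 + L / 2 * 2
⌊n/2⌋-upper L = ℕ.≤-trans (ℕ.≤-reflexive (m≡m%n+[m/n]*n L 2))
  (ℕ.+-monoˡ-≤ (L / 2 * 2) (ℕ.≤-pred (m%n<n L 2)))

⌊n/2⌋-lower : ∀ L → L / 2 * 2 ≤ L
⌊n/2⌋-lower L = ℕ.≤-trans (ℕ.m≤n+m (L / 2 * 2) (L % 2)) (ℕ.≤-reflexive (sym (m≡m%n+[m/n]*n L 2)))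

-- With h = ⌊L/2⌋ the left side is at most a quadratic in h times 2^h; the quadratic is at most 24 ·
-- 2^h, and 2^h · 2^h ≤ 2^L.
retained-bound : ∀ L → retained L * L ≤ 24 * 2 ^ L
retained-bound L = begin
  (L + 2) * (2 * 2 ^ h) * L                          ≤⟨ ℕ.*-mono-≤ (ℕ.*-monoˡ-≤ (2 * 2 ^ h) (ℕ.+-monoˡ-≤ 2 L≤)) L≤ ⟩
  -- As 2 (2h + 3)(2h + 1) = 8 h² + 16 h + 6, adding 18 completes the quadratic bounded above.
  (1 + h * 2 + 2) * (2 * 2 ^ h) * (1 + h * 2)        ≤⟨ ℕ.m≤m+n _ (18 * 2 ^ h) ⟩
  (1 + h * 2 + 2) * (2 * 2 ^ h) * (1 + h * 2) + 18 * 2 ^ h ≡⟨ expand h (2 ^ h) ⟩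
  (8 * (h * h) + 16 * h + 24) * 2 ^ h                ≤⟨ ℕ.*-monoˡ-≤ (2 ^ h) (quadratic≤24*2^ h) ⟩
  24 * 2 ^ h * 2 ^ h                                 ≡⟨ ℕ.*-assoc 24 (2 ^ h) (2 ^ h) ⟩
  24 * (2 ^ h * 2 ^ h)                               ≡⟨ cong (24 *_) (ℕ.^-distribˡ-+-* 2 h h) ⟨
  24 * 2 ^ (h + h)                                   ≤⟨ ℕ.*-monoʳ-≤ 24 (ℕ.^-monoʳ-≤ 2 h+h≤L) ⟩
  24 * 2 ^ L                                         ∎
  where
  open ℕ.≤-Reasoning
  h = L / 2
  L≤ = ⌊n/2⌋-upper L
  h+h≤L : h + h ≤ L
  h+h≤L = subst (_≤ L) (double h) (⌊n/2⌋-lower L)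
    where
    double : ∀ h → h * 2 ≡ h + h
    double = ℕ-Solver.solve-∀
  expand : ∀ h x → (1 + h * 2 + 2) * (2 * x) * (1 + h * 2) + 18 * x ≡ (8 * (h * h) + 16 * h + 24) * x
  expand = ℕ-Solver.solve-∀

-- From n ≤ 2^(L + 1) follow 2n ≤ 2^(L + 2), which fixes e, and n ≤ 4^s, because L + 1 ≤ 2 (⌊L/2⌋ +
-- 1) = 2 s.
reconstructible-from-retained : ∀ n → 0 < n → retained ⌊log₂ n ⌋ ≤ n →
  MultisetReconstructible n (n ∸ retained ⌊log₂ n ⌋)
reconstructible-from-retained n 0<n m≤n =
  subst (λ t → MultisetReconstructible t k) k+m≡n
    (reconstructible k (L + 2) (suc h) (subst (0 <_) (sym k+m≡n) 0<n)
      (subst (_≤ 4 ^ suc h) (sym k+m≡n) n≤4^s)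
      (subst (λ t → t + t ≤ 2 ^ (L + 2)) (sym k+m≡n) 2n≤2^e))
  where
  L = ⌊log₂ n ⌋
  h = L / 2
  m = retained L
  k = n ∸ m
  k+m≡n : k + m ≡ n
  k+m≡n = ℕ.m∸n+n≡m m≤n
  open ℕ.≤-Reasoning
  n≤2^[1+L] : n ≤ 2 ^ suc L
  n≤2^[1+L] = ℕ.<⇒≤ (n<2^[1+⌊log₂n⌋] n)
  n≤4^s : n ≤ 4 ^ suc h
  n≤4^s = begin
    n                   ≤⟨ n≤2^[1+L] ⟩
    2 ^ suc L           ≤⟨ ℕ.^-monoʳ-≤ 2 (s≤s (⌊n/2⌋-upper L)) ⟩
    2 ^ (suc h * 2)     ≡⟨ cong (2 ^_) (ℕ.*-comm (suc h) 2) ⟩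
    2 ^ (2 * suc h)     ≡⟨ ℕ.^-*-assoc 2 2 (suc h) ⟨
    4 ^ suc h           ∎
  2n≤2^e : n + n ≤ 2 ^ (L + 2)
  2n≤2^e = begin
    n + n                  ≤⟨ ℕ.+-mono-≤ n≤2^[1+L] n≤2^[1+L] ⟩
    2 ^ suc L + 2 ^ suc L  ≡⟨ cong (_+_ (2 ^ suc L)) (ℕ.+-identityʳ (2 ^ suc L)) ⟨
    2 ^ (2 + L)            ≡⟨ cong (2 ^_) (ℕ.+-comm 2 L) ⟩
    2 ^ (L + 2)            ∎

theorem5p1 : (G : ℕ → ℕ) →
    ((n : ℕ) → G n ≤ n × MultisetReconstructible n (G n)
    × ((k : ℕ) → k ≤ n → MultisetReconstructible n k → k ≤ G n)) →
    (((m : ℕ) → 1 ≤ m → ∃ λ N₀ → (n : ℕ) → N₀ ≤ n → m * (n ∸ G n) ≤ n)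
    × (∃ λ C → ∃ λ N₀ → (n : ℕ) → N₀ ≤ n → (n ∸ G n) * ⌊log₂ n ⌋ ≤ C * n))
-- The constant 48 is 24 from `retained-bound` times 2 from the bound 2^L ≤ 2n.
theorem5p1 G largest = little-o , 48 , 1 , big-O
  where
  open ℕ.≤-Reasoning

  deficit : ∀ n → 0 < n → n ∸ G n ≤ retained ⌊log₂ n ⌋
  deficit n 0<n with ℕ.≤-total (retained ⌊log₂ n ⌋) n
  ... | inj₁ m≤n = ℕ.m≤n+o⇒m∸n≤o n (G n) (ℕ.≤-trans (ℕ.m≤n+m∸n n m)
    (subst (m + k ≤_) (ℕ.+-comm m (G n)) (ℕ.+-monoʳ-≤ m k≤G)))
    where
    m = retained ⌊log₂ n ⌋
    k = n ∸ m
    k≤G : k ≤ G n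
    k≤G = proj₂ (proj₂ (largest n)) k (ℕ.m∸n≤m n m) (reconstructible-from-retained n 0<n m≤n)
  -- For n below the required degree the trivial bound n - G n ≤ n is enough.
  ... | inj₂ n≤m = ℕ.≤-trans (ℕ.m∸n≤m n (G n)) n≤m

  big-O : ∀ n → 1 ≤ n → (n ∸ G n) * ⌊log₂ n ⌋ ≤ 48 * n
  big-O n 0<n = begin
    (n ∸ G n) * L       ≤⟨ ℕ.*-monoˡ-≤ L (deficit n 0<n) ⟩
    retained L * L      ≤⟨ retained-bound L ⟩
    24 * 2 ^ L          ≤⟨ ℕ.*-monoʳ-≤ 24 (2^⌊log₂n⌋≤2n n 0<n) ⟩
    24 * (2 * n)        ≡⟨ ℕ.*-assoc 24 2 n ⟨
    48 * n              ∎
    where L = ⌊log₂ n ⌋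

  little-o : ∀ m → 1 ≤ m → ∃ λ N₀ → ∀ n → N₀ ≤ n → m * (n ∸ G n) ≤ n
  -- From this threshold on the logarithm is at least 48 m, so the bound 48 n of `big-O` gives the
  -- claim after cancelling 48.
  little-o m _ = 2 ^ (48 * m) , λ n le → ℕ.*-cancelˡ-≤ 48 (begin
    48 * (m * (n ∸ G n))        ≡⟨ ℕ.*-assoc 48 m (n ∸ G n) ⟨
    48 * m * (n ∸ G n)          ≡⟨ ℕ.*-comm (48 * m) (n ∸ G n) ⟩
    (n ∸ G n) * (48 * m)        ≡⟨ cong (_*_ (n ∸ G n)) (⌊log₂[2^n]⌋≡n (48 * m)) ⟨
    (n ∸ G n) * ⌊log₂ 2 ^ (48 * m) ⌋  ≤⟨ ℕ.*-monoʳ-≤ (n ∸ G n) (⌊log₂⌋-mono-≤ le) ⟩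
    (n ∸ G n) * ⌊log₂ n ⌋       ≤⟨ big-O n (ℕ.≤-trans (ℕ.m^n>0 2 (48 * m)) le) ⟩
    48 * n                      ∎)
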